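{- For every integer $n\ge 8$, $\bigl|\mathrm{LE}(n)\cap((n-1)!,\,n!]\bigr|<(n-3)!$.
   Context: All posets are finite. For a finite poset $P$, $\mathrm{ext}(P)$ denotes the number of linear extensions of $P$. For a positive integer $n$, $\mathrm{LE}(n)=\{\mathrm{ext}(P): P \text{ a poset with } |P|=n\}$. -}

module Defs where

open import Data.Fin as Fin using (Fin)
import Data.Fin.Properties as Fin
open import Data.List using (List; []; _∷_; length; filter; allFin; cartesianProductWith)
open import Data.List.Membership.Propositional using (_∈_)
open import Data.List.Membership.Propositional.Properties using (∈-cartesianProductWith⁺; ∈-filter⁺; ∈-filter⁻; ∈-allFin)
open import Data.List.Relation.Unary.All using ([])
open import Data.List.Relation.Unary.AllPairs using ([]; _∷_)
open import Data.List.Relation.Unary.Any using (here)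
open import Data.List.Relation.Unary.Unique.Propositional using (Unique)
open import Data.List.Relation.Unary.Unique.Propositional.Properties using (cartesianProductWith⁺; allFin⁺; filter⁺)
open import Data.Nat using (ℕ; zero; suc; _<_; _≤_)
open import Data.Product using (∃; _×_; _,_; proj₁; proj₂)
open import Data.Vec using (Vec; []; _∷_; lookup)
open import Data.Vec.Properties using (∷-injective)
open import Function.Bundles using (_⇔_; mk⇔)
open import Function.Definitions using (Injective; Surjective; Bijective)
open import Level using (Level; 0ℓ; _⊔_) renaming (suc to lsuc)
open import Relation.Binary using (Rel; IsDecPartialOrder; _Preserves_⟶_)
open import Relation.Binary.PropositionalEquality using (_≡_; refl; cong; trans)
open import Relation.Nullary.Decidable using (Dec; map′; _×-dec_; _→-dec_)
open import Relation.Unary using (Pred; Decidable)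

-- The subset S of A is finite with exactly m elements: some list enumerates
-- S without repetition and has length m.
HasCardinality : {a ℓ : Level} {A : Set a} → Pred A ℓ → ℕ → Set (a ⊔ ℓ)
HasCardinality {A = A} S m =
  ∃ λ (xs : List A) → Unique xs × (∀ x → x ∈ xs ⇔ S x) × length xs ≡ m

-- A poset P with |P| = n; its underlying set is labelled by Fin n.
record FinPoset (n : ℕ) : Set (lsuc 0ℓ) where
  field
    _≤ₚ_              : Rel (Fin n) 0ℓ
    isDecPartialOrder : IsDecPartialOrder _≡_ _≤ₚ_

  open IsDecPartialOrder isDecPartialOrder public using () renaming (_≤?_ to _≤ₚ?_)

-- An order-preserving bijection from P to the n-element chain; lookup f x is
-- the position of x.  Functions are stored as vectors so that _≡_ is
-- extensional equality.
IsLinearExtension : {n : ℕ} → FinPoset n → Pred (Vec (Fin n) n) 0ℓ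
IsLinearExtension P f =
  Bijective _≡_ _≡_ (lookup f) × lookup f Preserves _≤ₚ_ ⟶ Fin._≤_
  where open FinPoset P

isLinearExtension? : {n : ℕ} (P : FinPoset n) → Decidable (IsLinearExtension P)
isLinearExtension? P f = (injective? ×-dec surjective?) ×-dec monotone?
  where
  open FinPoset P
  injective? : Dec (Injective _≡_ _≡_ (lookup f))
  injective? = map′ (λ h {x} {y} → h x y) (λ h x y → h {x} {y})
    (Fin.all? λ x → Fin.all? λ y → (lookup f x Fin.≟ lookup f y) →-dec (x Fin.≟ y))
  surjective? : Dec (Surjective _≡_ _≡_ (lookup f))
  surjective? = map′
    (λ h y → proj₁ (h y) , λ z≡x → trans (cong (lookup f) z≡x) (proj₂ (h y)))
    (λ h y → proj₁ (h y) , proj₂ (h y) refl)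
    (Fin.all? λ y → Fin.any? λ x → lookup f x Fin.≟ y)
  monotone? : Dec (lookup f Preserves _≤ₚ_ ⟶ Fin._≤_)
  monotone? = map′ (λ h {x} {y} → h x y) (λ h x y → h {x} {y})
    (Fin.all? λ x → Fin.all? λ y → (x ≤ₚ? y) →-dec (lookup f x Fin.≤? lookup f y))

allVecs : (m n : ℕ) → List (Vec (Fin m) n)
allVecs m zero    = [] ∷ []
allVecs m (suc n) = cartesianProductWith _∷_ (allFin m) (allVecs m n)

ext : {n : ℕ} → FinPoset n → ℕ
ext {n} P = length (filter (isLinearExtension? P) (allVecs n n))

∈-allVecs : {m n : ℕ} (v : Vec (Fin m) n) → v ∈ allVecs m n
∈-allVecs []      = here refl
∈-allVecs (x ∷ v) = ∈-cartesianProductWith⁺ _∷_ (∈-allFin x) (∈-allVecs v)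

allVecs-unique : (m n : ℕ) → Unique (allVecs m n)
allVecs-unique m zero    = [] ∷ []
allVecs-unique m (suc n) =
  cartesianProductWith⁺ _∷_ ∷-injective (allFin⁺ m) (allVecs-unique m n)

ext-cardinality : {n : ℕ} (P : FinPoset n) → HasCardinality (IsLinearExtension P) (ext P)
ext-cardinality {n} P =
  filter (isLinearExtension? P) (allVecs n n) ,
  filter⁺ (isLinearExtension? P) (allVecs-unique n n) ,
  (λ f → mk⇔ (λ f∈ → proj₂ (∈-filter⁻ (isLinearExtension? P) {xs = allVecs n n} f∈))
             (∈-filter⁺ (isLinearExtension? P) (∈-allVecs f))) ,
  refl

LE : ℕ → Pred ℕ (lsuc 0ℓ)
LE n k = ∃ λ (P : FinPoset n) → ext P ≡ k

⦅_,_⟧ : ℕ → ℕ → Pred ℕ 0ℓ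
⦅ a , b ⟧ k = a < k × k ≤ b

{-# OPTIONS --safe #-}

-- An isolated point of an n-element poset can take any of the n positions, so
-- deleting it divides ext by n.  With three isolated points ext P is therefore
-- j n (n-1) (n-2), where 3 < j ≤ (n-3)! because (n-1)! < ext P ≤ n! and
-- 3 n ≤ (n-3)!; this leaves (n-3)! - 3 values.
--
-- Otherwise at most two isolated points are deleted, leaving m ≥ 6 points, none
-- of them isolated.  The comparability graph is then covered by disjoint stars.
-- If a star has centre c, the bijections f ∘ (c x), with x in the star and f a
-- linear extension, are pairwise distinct, and disjoint stars can be treated one
-- after another, so ext times the product of the sizes is at most m!.
-- Two or more stars have product at least 2 m - 4 ≥ m + 2, too much for
-- ext P > (n-1)!.  So there is one star; for the same reason no two points other
-- than its centre are comparable, whence ext = (m-1)!.  This is impossible for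
-- m = n and gives one value each for m = n-1 and m = n-2.
module Submission where

open import Defs
open import Data.Fin as Fin using (Fin; punchIn; punchOut)
import Data.Fin.Properties as Fin
open import Data.Fin.Permutation.Components using (transpose)
open import Data.List as List using (List; []; _∷_; _++_; length; filter; allFin; cartesianProductWith; concatMap; deduplicate; upTo)
open import Data.List.Properties using (length-++; length-map; length-tabulate; length-upTo; concatMap-++; ++-identityʳ)
open import Data.List.Membership.Propositional using (_∈_)
open import Data.List.Membership.Propositional.Properties
open import Data.List.Relation.Binary.Disjoint.Propositional using (Disjoint)
open import Data.List.Relation.Binary.Permutation.Propositional using (_↭_; ↭-refl; ↭-sym; ↭-trans; prep; swap; ↭⇒↭ₛ; ↭-reflexive)
open import Data.List.Relation.Binary.Permutation.Propositional.Properties using (All-resp-↭; ∈-resp-↭; ↭-length; shift; ++⁺ˡ; ++⁺ʳ)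
import Data.List.Relation.Binary.Permutation.Setoid.Properties as ↭ₛ
open import Data.List.Relation.Binary.Subset.Propositional using (_⊆_)
open import Data.List.Relation.Unary.All as All using (All; []; _∷_)
import Data.List.Relation.Unary.All.Properties as All
open import Data.List.Relation.Unary.AllPairs using ([]; _∷_)
open import Data.List.Relation.Unary.Any using (here; there)
open import Data.List.Relation.Unary.Unique.Propositional using (Unique)
import Data.List.Relation.Unary.Unique.Propositional.Properties as Unique
open import Data.List.Relation.Unary.Unique.DecPropositional.Properties using (deduplicate-!)
open import Data.Nat using (ℕ; zero; suc; _+_; _*_; _≤_; _<_; _∸_; _!; z≤n; s≤s)
import Data.Nat.Properties as ℕ
open import Data.Nat.Tactic.RingSolver using (solve-∀)
open import Data.Product using (∃; ∃₂; _×_; _,_; proj₁; proj₂)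
open import Data.Sum using (_⊎_; inj₁; inj₂; [_,_]′)
open import Data.Vec as Vec using (Vec; lookup; tabulate; insertAt)
open import Data.Vec.Properties using (lookup-map; lookup∘tabulate; tabulate∘lookup; tabulate-cong; insertAt-lookup; insertAt-punchIn)
open import Function using (_∘_; id)
open import Function.Bundles using (mk⇔; module Equivalence)
open import Function.Definitions using (Injective; Surjective)
open import Level using (Level)
open import Relation.Binary using (IsDecPartialOrder)
open import Relation.Binary.PropositionalEquality
open import Relation.Nullary using (¬_; Dec; yes; no; contradiction)
open import Relation.Nullary.Decidable using (_×-dec_; _⊎-dec_; _→-dec_; ¬?; decidable-stable)
open import Relation.Unary using (_∩_)

private variable
  ℓ : Level
  A B C : Set ℓ
  n : ℕ

-- Counting with duplicate-free lists

unique-⊆⇒length≤ : {xs ys : List A} → Unique xs → xs ⊆ ys → length xs ≤ length ys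
unique-⊆⇒length≤ {xs = []} _ _ = z≤n
unique-⊆⇒length≤ {xs = x ∷ xs} (x∉ ∷ u) sub with ∈-∃++ (sub (here refl))
... | as , bs , refl = subst (suc (length xs) ≤_) (sym (↭-length (shift x as bs)))
  (s≤s (unique-⊆⇒length≤ u λ y∈ → skip (All.lookup x∉ y∈) (∈-resp-↭ (shift x as bs) (sub (there y∈)))))
  where
  skip : ∀ {y zs} → x ≢ y → y ∈ x ∷ zs → y ∈ zs
  skip x≢y (here y≡x) = contradiction (sym y≡x) x≢y
  skip _   (there y∈) = y∈

unique-map-on : (f : A → B) {xs : List A} → (∀ {x y} → x ∈ xs → y ∈ xs → f x ≡ f y → x ≡ y) →
                Unique xs → Unique (List.map f xs)
unique-map-on f inj []       = []
unique-map-on f inj (x∉ ∷ u) =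
  All.map⁺ (All.tabulate λ y∈ eq → All.lookup x∉ y∈ (inj (here refl) (there y∈) eq)) ∷
  unique-map-on f (λ x∈ y∈ → inj (there x∈) (there y∈)) u

-- Injectivity is asked for only on members of the two lists, because `exchange` is injective only
-- on vectors that respect the star in question.
unique-cartesianProductWith-on : (f : A → B → C) {xs : List A} {ys : List B} →
  (∀ {w x y z} → w ∈ xs → x ∈ xs → y ∈ ys → z ∈ ys → f w y ≡ f x z → w ≡ x × y ≡ z) →
  Unique xs → Unique ys → Unique (cartesianProductWith f xs ys)
unique-cartesianProductWith-on f inj [] _ = []
unique-cartesianProductWith-on f {x ∷ xs} {ys} inj (x∉ ∷ u) v = Unique.++⁺
  (unique-map-on (f x) (λ y∈ z∈ eq → proj₂ (inj (here refl) (here refl) y∈ z∈ eq)) v)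
  (unique-cartesianProductWith-on f (λ w∈ x∈ → inj (there w∈) (there x∈)) u v)
  disjoint
  where
  disjoint : Disjoint (List.map (f x) ys) (cartesianProductWith f xs ys)
  disjoint (p , q) with ∈-map⁻ (f x) p | ∈-cartesianProductWith⁻ f xs ys q
  ... | y , y∈ , refl | x′ , z , x′∈ , z∈ , eq =
    All.lookup x∉ x′∈ (proj₁ (inj (here refl) (there x′∈) y∈ z∈ eq))

length-cartesianProductWith : (f : A → B → C) (xs : List A) (ys : List B) →
  length (cartesianProductWith f xs ys) ≡ length xs * length ys
length-cartesianProductWith f []       ys = refl
length-cartesianProductWith f (x ∷ xs) ys = trans (length-++ (List.map (f x) ys))
  (cong₂ _+_ (length-map (f x) ys) (length-cartesianProductWith f xs ys))

unique-++⁻ : (xs {ys} : List A) → Unique (xs ++ ys) → Unique xs × Unique ys × Disjoint xs ys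
unique-++⁻ [] u = [] , u , λ ()
unique-++⁻ (x ∷ xs) (x∉ ∷ u) with unique-++⁻ xs u
... | uxs , uys , dis = All.++⁻ˡ xs x∉ ∷ uxs , uys ,
  λ { (here refl , ∈ys) → All.lookup x∉ (∈-++⁺ʳ xs ∈ys) refl ; (there ∈xs , ∈ys) → dis (∈xs , ∈ys) }

Unique-resp-↭ : {xs ys : List A} → xs ↭ ys → Unique xs → Unique ys
Unique-resp-↭ p = ↭ₛ.Unique-resp-↭ (setoid _) (↭⇒↭ₛ p)

lookup-ext : {f g : Vec A n} → (∀ i → lookup f i ≡ lookup g i) → f ≡ g
lookup-ext {f = f} {g} eq = trans (sym (tabulate∘lookup f)) (trans (tabulate-cong eq) (tabulate∘lookup g))

-- A missed value `y` could be punched out of the codomain, leaving an injection from `Fin (suc n)`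
-- to `Fin n`.
injective⇒surjective : (f : Fin n → Fin n) → Injective _≡_ _≡_ f → Surjective _≡_ _≡_ f
injective⇒surjective {zero}  f inj ()
injective⇒surjective {suc n} f inj y with Fin.any? (λ x → f x Fin.≟ y)
... | yes (x , fx≡y) = x , λ { refl → fx≡y }
... | no ¬∃ = contradiction (Fin.injective⇒≤ {f = λ x → punchOut (y≢ x)}
      λ {i} {j} eq → inj (Fin.punchOut-injective (y≢ i) (y≢ j) eq)) ℕ.1+n≰n
  where
  y≢ : ∀ x → y ≢ f x
  y≢ x y≡ = ¬∃ (x , sym y≡)

-- Linear extensions as injective vectors

InjectiveVec : Vec (Fin n) n → Set
InjectiveVec f = Injective _≡_ _≡_ (lookup f)

Monotone : FinPoset n → Vec (Fin n) n → Set
Monotone P f = ∀ {x y} → x ≤ₚ y → lookup f x Fin.≤ lookup f y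
  where open FinPoset P

mkLinearExtension : (P : FinPoset n) (f : Vec (Fin n) n) → InjectiveVec f → Monotone P f → IsLinearExtension P f
mkLinearExtension P f inj mono = ((λ {x} {y} → inj {x} {y}) , injective⇒surjective (lookup f) inj) , λ {x} {y} → mono {x} {y}

linearExtensions : FinPoset n → List (Vec (Fin n) n)
linearExtensions P = proj₁ (ext-cardinality P)

linearExtensions-unique : (P : FinPoset n) → Unique (linearExtensions P)
linearExtensions-unique P = proj₁ (proj₂ (ext-cardinality P))

module _ (P : FinPoset n) {f : Vec (Fin n) n} where
  open Equivalence (proj₁ (proj₂ (proj₂ (ext-cardinality P))) f) public
    renaming (to to ∈-linearExtensions⁻; from to ∈-linearExtensions⁺)

  ∈-linearExtensions⇒injective : f ∈ linearExtensions P → InjectiveVec f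
  ∈-linearExtensions⇒injective f∈ = proj₁ (proj₁ (∈-linearExtensions⁻ f∈))

ext-unique : (P : FinPoset n) {fs : List (Vec (Fin n) n)} → Unique fs →
  (∀ {f} → f ∈ fs → IsLinearExtension P f) → (∀ {f} → IsLinearExtension P f → f ∈ fs) → ext P ≡ length fs
ext-unique P u sound complete = ℕ.≤-antisym
  (unique-⊆⇒length≤ (linearExtensions-unique P) (complete ∘ ∈-linearExtensions⁻ P))
  (unique-⊆⇒length≤ u (∈-linearExtensions⁺ P ∘ sound))

-- Equivalent relations need not be equal types. This is how a poset is compared with the one
-- rebuilt from its matrix.
ext-cong : (P Q : FinPoset n) →
  (∀ {x y} → FinPoset._≤ₚ_ P x y → FinPoset._≤ₚ_ Q x y) →
  (∀ {x y} → FinPoset._≤ₚ_ Q x y → FinPoset._≤ₚ_ P x y) → ext P ≡ ext Q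
ext-cong P Q P⇒Q Q⇒P = ext-unique P (linearExtensions-unique Q)
  (λ f∈ → let bij , mono = ∈-linearExtensions⁻ Q f∈ in bij , λ {_} {_} → mono ∘ P⇒Q)
  (λ (bij , mono) → ∈-linearExtensions⁺ Q (bij , λ {_} {_} → mono ∘ Q⇒P))

-- The comparability graph

module _ (P : FinPoset n) where
  open FinPoset P

  Adjacent : Fin n → Fin n → Set
  Adjacent x y = x ≢ y × (x ≤ₚ y ⊎ y ≤ₚ x)

  adjacent? : ∀ x y → Dec (Adjacent x y)
  adjacent? x y = ¬? (x Fin.≟ y) ×-dec ((x ≤ₚ? y) ⊎-dec (y ≤ₚ? x))

  adjacent-sym : ∀ {x y} → Adjacent x y → Adjacent y x
  adjacent-sym (x≢y , inj₁ x≤y) = (x≢y ∘ sym) , inj₂ x≤y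
  adjacent-sym (x≢y , inj₂ y≤x) = (x≢y ∘ sym) , inj₁ y≤x

  Isolated : Fin n → Set
  Isolated x = ∀ y → ¬ Adjacent x y

  NoIsolated : Set
  NoIsolated = ∀ x → ∃ λ y → Adjacent x y

  isolated? : ∃ Isolated ⊎ NoIsolated
  isolated? with Fin.all? (λ x → Fin.any? (adjacent? x))
  ... | yes h = inj₂ h
  ... | no ¬h with Fin.¬∀⟶∃¬ _ _ (λ x → Fin.any? (adjacent? x)) ¬h
  ...   | x , ¬adj = inj₁ (x , λ y adj → ¬adj (y , adj))

-- Removal of an isolated point

remove : FinPoset (suc n) → Fin (suc n) → FinPoset n
remove P x = record
  { _≤ₚ_ = λ i j → punchIn x i ≤ₚ punchIn x j
  ; isDecPartialOrder = record
    { isPartialOrder = record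
      { isPreorder = record
        { isEquivalence = isEquivalence
        ; reflexive = λ i≡j → PO.reflexive (cong (punchIn x) i≡j)
        ; trans = PO.trans }
      ; antisym = λ i≤j j≤i → Fin.punchIn-injective x _ _ (PO.antisym i≤j j≤i) }
    ; _≟_ = Fin._≟_
    ; _≤?_ = λ i j → punchIn x i ≤ₚ? punchIn x j } }
  where
  open FinPoset P
  module PO = IsDecPartialOrder isDecPartialOrder

data PunchView (x : Fin (suc n)) : Fin (suc n) → Set where
  hole    : PunchView x x
  punched : ∀ j → PunchView x (punchIn x j)

punchView : (x y : Fin (suc n)) → PunchView x y
punchView x y with x Fin.≟ y
... | yes refl = hole
... | no x≢y = subst (PunchView x) (Fin.punchIn-punchOut x≢y) (punched (punchOut x≢y))

module _ (x : Fin (suc n)) where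

  place : Fin (suc n) → Vec (Fin n) n → Vec (Fin (suc n)) (suc n)
  place v g = insertAt (Vec.map (punchIn v) g) x v

  place-hole : ∀ v g → lookup (place v g) x ≡ v
  place-hole v g = insertAt-lookup _ x v

  place-punchIn : ∀ v g j → lookup (place v g) (punchIn x j) ≡ punchIn v (lookup g j)
  place-punchIn v g j = trans (insertAt-punchIn _ x v j) (lookup-map j (punchIn v) g)

  place-injective : ∀ {v w g h} → place v g ≡ place w h → v ≡ w × g ≡ h
  place-injective {v} {w} {g} {h} eq with trans (sym (place-hole v g)) (trans (cong (λ f → lookup f x) eq) (place-hole w h))
  ... | refl = refl , lookup-ext λ j → Fin.punchIn-injective v _ _
    (trans (sym (place-punchIn v g j)) (trans (cong (λ f → lookup f (punchIn x j)) eq) (place-punchIn v h j)))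

  place-injectiveVec : ∀ v g → InjectiveVec g → InjectiveVec (place v g)
  place-injectiveVec v g inj {i} {j} eq with punchView x i | punchView x j
  ... | hole | hole = refl
  ... | hole | punched j′ = contradiction
    (trans (sym (place-punchIn v g j′)) (trans (sym eq) (place-hole v g))) (Fin.punchInᵢ≢i v _)
  ... | punched i′ | hole = contradiction
    (trans (sym (place-punchIn v g i′)) (trans eq (place-hole v g))) (Fin.punchInᵢ≢i v _)
  ... | punched i′ | punched j′ = cong (punchIn x) (inj (Fin.punchIn-injective v _ _
    (trans (sym (place-punchIn v g i′)) (trans eq (place-punchIn v g j′)))))

  unplace : (f : Vec (Fin (suc n)) (suc n)) → InjectiveVec f → ∃₂ λ v g → f ≡ place v g
  unplace f inj = v , g , lookup-ext eq
    where
    v = lookup f x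
    v≢ : ∀ j → v ≢ lookup f (punchIn x j)
    v≢ j e = Fin.punchInᵢ≢i x j (sym (inj e))
    g = tabulate (λ j → punchOut (v≢ j))
    eq : ∀ i → lookup f i ≡ lookup (place v g) i
    eq i with punchView x i
    ... | hole = sym (place-hole v g)
    ... | punched j = sym (trans (place-punchIn v g j)
          (trans (cong (punchIn v) (lookup∘tabulate _ j)) (Fin.punchIn-punchOut (v≢ j))))

  unplace-injectiveVec : ∀ v g → InjectiveVec (place v g) → InjectiveVec g
  unplace-injectiveVec v g inj {i} {j} eq = Fin.punchIn-injective x _ _
    (inj (trans (place-punchIn v g i) (trans (cong (punchIn v) eq) (sym (place-punchIn v g j)))))

-- `place x` is a bijection from pairs of a position and a linear extension of `remove P x`:
-- inserting `x` keeps the relative order of the other points. Isolation makes the mixed cases of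
-- monotonicity vacuous.
ext-remove : (P : FinPoset (suc n)) (x : Fin (suc n)) → Isolated P x → ext P ≡ suc n * ext (remove P x)
ext-remove {n} P x iso = trans (ext-unique P unique sound complete)
  (trans (length-cartesianProductWith (place x) (allFin (suc n)) (linearExtensions (remove P x)))
         (cong (_* ext (remove P x)) (length-tabulate {n = suc n} id)))
  where
  open FinPoset P
  fs = cartesianProductWith (place x) (allFin (suc n)) (linearExtensions (remove P x))

  unique : Unique fs
  unique = Unique.cartesianProductWith⁺ (place x) (place-injective x) (Unique.allFin⁺ _) (linearExtensions-unique (remove P x))

  sound : ∀ {f} → f ∈ fs → IsLinearExtension P f
  sound f∈ with ∈-cartesianProductWith⁻ (place x) (allFin (suc n)) (linearExtensions (remove P x)) f∈
  ... | v , g , _ , g∈ , refl = mkLinearExtension P (place x v g) (place-injectiveVec x v g (∈-linearExtensions⇒injective (remove P x) g∈)) mono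
    where
    mono : Monotone P (place x v g)
    mono {i} {j} i≤j with punchView x i | punchView x j
    ... | hole | hole = ℕ.≤-refl
    ... | hole | punched j′ = contradiction ((Fin.punchInᵢ≢i x j′ ∘ sym) , inj₁ i≤j) (iso _)
    ... | punched i′ | hole = contradiction ((Fin.punchInᵢ≢i x i′ ∘ sym) , inj₂ i≤j) (iso _)
    ... | punched i′ | punched j′ = subst₂ Fin._≤_ (sym (place-punchIn x v g i′)) (sym (place-punchIn x v g j′))
      (Fin.punchIn-mono-≤ v _ _ (proj₂ (∈-linearExtensions⁻ (remove P x) g∈) i≤j))

  complete : ∀ {f} → IsLinearExtension P f → f ∈ fs
  complete {f} ((inj , _) , mono) with unplace x f inj
  ... | v , g , refl = ∈-cartesianProductWith⁺ (place x) (∈-allFin v) (∈-linearExtensions⁺ (remove P x)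
    (mkLinearExtension (remove P x) g (unplace-injectiveVec x v g inj) λ i≤j → Fin.punchIn-cancel-≤ v _ _
      (subst₂ Fin._≤_ (place-punchIn x v g _) (place-punchIn x v g _) (mono i≤j))))

-- Antichains

ext-antichain : (P : FinPoset n) → (∀ x → Isolated P x) → ext P ≡ n !
ext-antichain {zero}  P iso = refl
ext-antichain {suc n} P iso = trans (ext-remove P Fin.zero (iso Fin.zero))
  (cong (suc n *_) (ext-antichain (remove P Fin.zero) λ x y (x≢y , cmp) → iso _ _ ((x≢y ∘ Fin.punchIn-injective Fin.zero _ _) , cmp)))

antichain : ∀ n → FinPoset n
antichain n = record
  { _≤ₚ_ = _≡_
  ; isDecPartialOrder = record
    { isPartialOrder = record
      { isPreorder = record { isEquivalence = isEquivalence ; reflexive = id ; trans = trans }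
      ; antisym = λ x≡y _ → x≡y }
    ; _≟_ = Fin._≟_
    ; _≤?_ = Fin._≟_ } }

-- Lets the linear extensions of the antichain serve as the list of all `n !` bijections in the
-- upper and lower bounds below.
ext-antichain≡n! : ∀ n → ext (antichain n) ≡ n !
ext-antichain≡n! n = ext-antichain (antichain n) λ x y (x≢y , cmp) → x≢y ([ id , sym ]′ cmp)

injectiveVec⇒∈ : {f : Vec (Fin n) n} → InjectiveVec f → f ∈ linearExtensions (antichain n)
injectiveVec⇒∈ {n} {f} inj = ∈-linearExtensions⁺ (antichain n)
  (mkLinearExtension (antichain n) f inj λ { refl → ℕ.≤-refl })

-- Star covers of the comparability graph

sum≤product : ∀ {a b} → 2 ≤ a → 2 ≤ b → a + b ≤ a * b
sum≤product {suc (suc a)} {suc (suc b)} (s≤s (s≤s _)) (s≤s (s≤s _)) =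
  ℕ.m+n≤o⇒m≤o ((2 + a) + (2 + b)) (ℕ.≤-reflexive (sym (identity a b)))
  where
  identity : ∀ a b → (2 + a) * (2 + b) ≡ (2 + a) + (2 + b) + (a + b + a * b)
  identity = solve-∀

-- This is (a - 2)(b - 2) ≥ 0. The factor 2 on the sum is what lifts the weight of two or more stars
-- to `2 n - 4`.
2*sum≤product+4 : ∀ {a b} → 2 ≤ a → 2 ≤ b → 2 * (a + b) ≤ a * b + 4
2*sum≤product+4 {suc (suc a)} {suc (suc b)} (s≤s (s≤s _)) (s≤s (s≤s _)) =
  ℕ.m+n≤o⇒m≤o (2 * ((2 + a) + (2 + b))) (ℕ.≤-reflexive (sym (identity a b)))
  where
  identity : ∀ a b → (2 + a) * (2 + b) + 4 ≡ 2 * ((2 + a) + (2 + b)) + a * b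
  identity = solve-∀

-- Transpositions and their action on vectors

transpose-left : (i j : Fin n) → transpose i j i ≡ j
transpose-left i j with i Fin.≟ i
... | yes _   = refl
... | no  i≢i = contradiction refl i≢i

transpose-right : (i j : Fin n) → transpose i j j ≡ i
transpose-right i j with j Fin.≟ i
... | yes j≡i = j≡i
... | no  _ with j Fin.≟ j
...   | yes _   = refl
...   | no  j≢j = contradiction refl j≢j

transpose-other : (i j : Fin n) {k : Fin n} → k ≢ i → k ≢ j → transpose i j k ≡ k
transpose-other i j {k} k≢i k≢j with k Fin.≟ i
... | yes k≡i = contradiction k≡i k≢i
... | no  _ with k Fin.≟ j
...   | yes k≡j = contradiction k≡j k≢j
...   | no  _   = refl

transpose-involutive : (i j k : Fin n) → transpose i j (transpose i j k) ≡ k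
transpose-involutive i j k = by-cases (k Fin.≟ i) (k Fin.≟ j)
  where
  by-cases : Dec (k ≡ i) → Dec (k ≡ j) → transpose i j (transpose i j k) ≡ k
  by-cases (yes refl) _          = trans (cong (transpose i j) (transpose-left i j)) (transpose-right i j)
  by-cases (no _)     (yes refl) = trans (cong (transpose i j) (transpose-right i j)) (transpose-left i j)
  by-cases (no k≢i)   (no k≢j)   = trans (cong (transpose i j) fixed) fixed
    where fixed = transpose-other i j k≢i k≢j

exchange : Fin n → Fin n → Vec A n → Vec A n
exchange i j f = tabulate (lookup f ∘ transpose i j)

lookup-exchange : (i j : Fin n) (f : Vec A n) (k : Fin n) → lookup (exchange i j f) k ≡ lookup f (transpose i j k)
lookup-exchange i j f = lookup∘tabulate (lookup f ∘ transpose i j)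

exchange-injectiveVec : (i j : Fin n) (f : Vec (Fin n) n) → InjectiveVec f → InjectiveVec (exchange i j f)
exchange-injectiveVec i j f inj {k} {l} eq = trans (sym (transpose-involutive i j k)) (trans
  (cong (transpose i j) (inj (trans (sym (lookup-exchange i j f k)) (trans eq (lookup-exchange i j f l)))))
  (transpose-involutive i j l))

-- The argument witnesses that `Fin n` is inhabited.
least : Fin n → ∃ λ (e : Fin n) → ∀ (i : Fin n) → e Fin.≤ i
least {suc n} _ = Fin.zero , λ _ → z≤n

greatest : Fin n → ∃ λ (e : Fin n) → ∀ (i : Fin n) → i Fin.≤ e
greatest {suc n} _ = Fin.fromℕ n , λ i → Fin.≤fromℕ i

-- Stars and the exchanges at their centres

module _ (P : FinPoset n) where
  open FinPoset P

  -- The first leaf is kept apart so that every star has an edge and size at least 2. Distinctness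
  -- of the vertices is imposed later, for a whole family at once, by `Unique (allVertices σ)`.
  record Star : Set where
    constructor star
    field
      centre leaf : Fin n
      leaves      : List (Fin n)
      adjacent    : All (Adjacent P centre) (leaf ∷ leaves)

    vertices : List (Fin n)
    vertices = centre ∷ leaf ∷ leaves

    size : ℕ
    size = 2 + length leaves

  open Star

  OrderedOn : Vec (Fin n) n → Fin n → Fin n → Set
  OrderedOn f x y = (x ≤ₚ y → lookup f x Fin.≤ lookup f y) × (y ≤ₚ x → lookup f y Fin.≤ lookup f x)

  -- Exchanged vectors may fail to be monotone, but they still respect the stars disjoint from the
  -- one being treated. This weaker condition is therefore the invariant of the induction in
  -- `weight-bound`.
  Respects : Vec (Fin n) n → Star → Set
  Respects f s = ∀ {x} → x ∈ leaf s ∷ leaves s → OrderedOn f (centre s) x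

  monotone⇒respects : ∀ f → Monotone P f → ∀ s → Respects f s
  monotone⇒respects f mono s _ = mono , mono

  respects-exchange : ∀ {c x} s f → (∀ {y} → y ∈ vertices s → y ≢ c × y ≢ x) → Respects f s → Respects (exchange c x f) s
  respects-exchange {c} {x} s f away resp {y} y∈ with resp y∈
  ... | c≤y , y≤c = subst₂ Fin._≤_ (sym eq₁) (sym eq₂) ∘ c≤y , subst₂ Fin._≤_ (sym eq₂) (sym eq₁) ∘ y≤c
    where
    unmoved : ∀ {z} → z ∈ vertices s → lookup (exchange c x f) z ≡ lookup f z
    unmoved z∈ = trans (lookup-exchange c x f _)
      (cong (lookup f) (transpose-other c x (proj₁ (away z∈)) (proj₂ (away z∈))))
    eq₁ = unmoved (here refl)
    eq₂ = unmoved (there y∈)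

  module _ (s : Star) where
    private
      c = centre s

    centre<leaf : ∀ f → InjectiveVec f → Respects f s → ∀ {x} → x ∈ leaf s ∷ leaves s → c ≤ₚ x → lookup f c Fin.< lookup f x
    centre<leaf f inj resp x∈ c≤x = ℕ.≤∧≢⇒< (proj₁ (resp x∈) c≤x)
      (proj₁ (All.lookup (adjacent s) x∈) ∘ inj ∘ Fin.toℕ-injective)

    leaf<centre : ∀ f → InjectiveVec f → Respects f s → ∀ {x} → x ∈ leaf s ∷ leaves s → x ≤ₚ c → lookup f x Fin.< lookup f c
    leaf<centre f inj resp x∈ x≤c = ℕ.≤∧≢⇒< (proj₂ (resp x∈) x≤c)
      (proj₁ (All.lookup (adjacent s) x∈) ∘ sym ∘ inj ∘ Fin.toℕ-injective)

    module _ f g (f-inj : InjectiveVec f) (f-resp : Respects f s)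
                   (g-inj : InjectiveVec g) (g-resp : Respects g s) where

      -- Otherwise `f` and `g` would put the comparable points `c` and `x` in opposite orders.
      no-swap : ∀ {x} → x ∈ leaf s ∷ leaves s → lookup f c ≡ lookup g x → ¬ lookup f x ≡ lookup g c
      no-swap x∈ fc≡gx fx≡gc with proj₂ (All.lookup (adjacent s) x∈)
      ... | inj₁ c≤x = ℕ.<-asym (centre<leaf f f-inj f-resp x∈ c≤x)
        (subst₂ Fin._<_ (sym fx≡gc) (sym fc≡gx) (centre<leaf g g-inj g-resp x∈ c≤x))
      ... | inj₂ x≤c = ℕ.<-asym (leaf<centre f f-inj f-resp x∈ x≤c)
        (subst₂ Fin._<_ (sym fc≡gx) (sym fx≡gc) (leaf<centre g g-inj g-resp x∈ x≤c))

      -- All inequalities are rewritten as inequalities between values of `g`. If `x` and `y` lie on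
      -- the same side of `c`, one from `f` contradicts one from `g`; on opposite sides, one from
      -- `f` and two from `g` close a cycle.
      no-rotation : ∀ {x y} → x ∈ leaf s ∷ leaves s → y ∈ leaf s ∷ leaves s →
        lookup f c ≡ lookup g x → lookup f x ≡ lookup g y → ¬ lookup f y ≡ lookup g c
      no-rotation x∈ y∈ fc≡gx fx≡gy fy≡gc
        with proj₂ (All.lookup (adjacent s) x∈) | proj₂ (All.lookup (adjacent s) y∈)
      ... | inj₁ c≤x | inj₁ c≤y = ℕ.<-asym (centre<leaf g g-inj g-resp x∈ c≤x)
        (subst₂ Fin._<_ fc≡gx fy≡gc (centre<leaf f f-inj f-resp y∈ c≤y))
      ... | inj₂ x≤c | inj₂ y≤c = ℕ.<-asym (leaf<centre g g-inj g-resp x∈ x≤c)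
        (subst₂ Fin._<_ fy≡gc fc≡gx (leaf<centre f f-inj f-resp y∈ y≤c))
      ... | inj₂ x≤c | inj₁ c≤y = ℕ.<-asym (centre<leaf g g-inj g-resp y∈ c≤y)
        (ℕ.<-trans (subst₂ Fin._<_ fx≡gy fc≡gx (leaf<centre f f-inj f-resp x∈ x≤c)) (leaf<centre g g-inj g-resp x∈ x≤c))
      ... | inj₁ c≤x | inj₂ y≤c = ℕ.<-asym (leaf<centre g g-inj g-resp y∈ y≤c)
        (ℕ.<-trans (centre<leaf g g-inj g-resp x∈ c≤x) (subst₂ Fin._<_ fc≡gx fx≡gy (centre<leaf f f-inj f-resp x∈ c≤x)))

    -- If x ≢ y, then f and g differ by a transposition or a 3-cycle through c.
    exchange-injective : ∀ {f g} → InjectiveVec f → Respects f s → InjectiveVec g → Respects g s →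
      ∀ {x y} → x ∈ vertices s → y ∈ vertices s → exchange c x f ≡ exchange c y g → x ≡ y × f ≡ g
    exchange-injective {f} {g} f-inj f-resp g-inj g-resp {x} {y} x∈ y∈ eq = decide (x Fin.≟ y)
      where
      at : ∀ i → lookup f (transpose c x i) ≡ lookup g (transpose c y i)
      at i = trans (sym (lookup-exchange c x f i)) (trans (cong (λ h → lookup h i) eq) (lookup-exchange c y g i))

      at′ : ∀ i {j k} → transpose c x i ≡ j → transpose c y i ≡ k → lookup f j ≡ lookup g k
      at′ i refl refl = at i

      distinct : x ≢ y → x ∈ vertices s → y ∈ vertices s → x ≡ y × f ≡ g
      distinct x≢y (here refl) (here refl) = contradiction refl x≢y
      distinct x≢y (here refl) (there y∈) = contradiction
        (at′ y (transpose-other c c (x≢y ∘ sym) (x≢y ∘ sym)) (transpose-right c y))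
        (no-swap f g f-inj f-resp g-inj g-resp y∈ (at′ c (transpose-left c c) (transpose-left c y)))
      distinct x≢y (there x∈) (here refl) = contradiction
        (at′ c (transpose-left c x) (transpose-left c c))
        (no-swap f g f-inj f-resp g-inj g-resp x∈ (at′ x (transpose-right c x) (transpose-other c c x≢y x≢y)))
      distinct x≢y (there x∈) (there y∈) = contradiction
        (at′ y (transpose-other c x (leaf≢centre y∈) (x≢y ∘ sym)) (transpose-right c y))
        (no-rotation f g f-inj f-resp g-inj g-resp x∈ y∈
          (at′ x (transpose-right c x) (transpose-other c y (leaf≢centre x∈) x≢y))
          (at′ c (transpose-left c x) (transpose-left c y)))
        where
        leaf≢centre : ∀ {z} → z ∈ leaf s ∷ leaves s → z ≢ c
        leaf≢centre z∈ z≡c = proj₁ (All.lookup (adjacent s) z∈) (sym z≡c)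

      decide : Dec (x ≡ y) → x ≡ y × f ≡ g
      decide (yes refl) = refl , lookup-ext λ j →
        at′ (transpose c x j) (transpose-involutive c x j) (transpose-involutive c x j)
      decide (no x≢y) = distinct x≢y x∈ y∈

  -- The bound from a family of disjoint stars

  allVertices : List Star → List (Fin n)
  allVertices = concatMap vertices

  weight : List Star → ℕ
  weight []      = 1
  weight (s ∷ σ) = size s * weight σ

  -- Induction on `σ` with `fs` arbitrary. Treating `s` replaces `fs` by `size s * length fs`
  -- exchanged vectors, distinct by `exchange-injective`; they respect the remaining stars because
  -- only vertices of `s` have moved. When no star is left, `fs` is a list of distinct bijections.
  weight-bound : ∀ σ → Unique (allVertices σ) → ∀ {fs} → Unique fs →
    (∀ {f} → f ∈ fs → InjectiveVec f) → (∀ {f s} → f ∈ fs → s ∈ σ → Respects f s) → weight σ * length fs ≤ n !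
  weight-bound [] _ {fs} u inj _ = subst₂ _≤_ (sym (ℕ.+-identityʳ (length fs))) (ext-antichain≡n! n)
    (unique-⊆⇒length≤ u (injectiveVec⇒∈ ∘ inj))
  weight-bound (s ∷ σ) uσ {fs} u inj resp with unique-++⁻ (vertices s) uσ
  ... | us , uσ′ , disjoint = subst (_≤ n !) rearrange (weight-bound σ uσ′ {gs} u′ inj′ resp′)
    where
    gs = cartesianProductWith (exchange (centre s)) (vertices s) fs

    u′ : Unique gs
    u′ = unique-cartesianProductWith-on (exchange (centre s))
      (λ w∈ x∈ f∈ g∈ → exchange-injective s (inj f∈) (resp f∈ (here refl)) (inj g∈) (resp g∈ (here refl)) w∈ x∈)
      us u

    inj′ : ∀ {g} → g ∈ gs → InjectiveVec g
    inj′ g∈ with ∈-cartesianProductWith⁻ (exchange (centre s)) (vertices s) fs g∈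
    ... | x , f , _ , f∈ , refl = exchange-injectiveVec (centre s) x f (inj f∈)

    resp′ : ∀ {g t} → g ∈ gs → t ∈ σ → Respects g t
    resp′ {t = t} g∈ t∈ with ∈-cartesianProductWith⁻ (exchange (centre s)) (vertices s) fs g∈
    ... | x , f , x∈ , f∈ , refl = respects-exchange t f
      (λ y∈ → (λ { refl → disjoint (here refl , ∈σ y∈) }) , (λ { refl → disjoint (x∈ , ∈σ y∈) }))
      (resp f∈ (there t∈))
      where
      ∈σ : ∀ {y} → y ∈ vertices t → y ∈ allVertices σ
      ∈σ y∈ = ∈-concat⁺′ y∈ (∈-map⁺ vertices t∈)

    rearrange : weight σ * length gs ≡ size s * weight σ * length fs
    rearrange = trans (cong (weight σ *_) (length-cartesianProductWith (exchange (centre s)) (vertices s) fs))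
      (trans (sym (ℕ.*-assoc (weight σ) (size s) (length fs))) (cong (_* length fs) (ℕ.*-comm (weight σ) (size s))))

  ext-bound : ∀ σ → Unique (allVertices σ) → weight σ * ext P ≤ n !
  ext-bound σ u = weight-bound σ u (linearExtensions-unique P) (∈-linearExtensions⇒injective P)
    (λ {f} {s} f∈ _ → monotone⇒respects f (proj₂ (∈-linearExtensions⁻ P f∈)) s)

  2≤weight : ∀ s σ → 2 ≤ weight (s ∷ σ)
  2≤weight s []      = ℕ.≤-trans (s≤s (s≤s z≤n)) (ℕ.m≤m*n (size s) 1)
  2≤weight s (t ∷ σ) = ℕ.≤-trans (2≤weight t σ) (ℕ.m≤n*m (weight (t ∷ σ)) (size s))

  vertices≤weight : ∀ s σ → length (allVertices (s ∷ σ)) ≤ weight (s ∷ σ)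
  vertices≤weight s []      = ℕ.≤-reflexive (trans (cong length (++-identityʳ (vertices s))) (sym (ℕ.*-identityʳ (size s))))
  vertices≤weight s (t ∷ σ) = subst (_≤ weight (s ∷ t ∷ σ)) (sym (length-++ (vertices s)))
    (ℕ.≤-trans (ℕ.+-monoʳ-≤ (size s) (vertices≤weight t σ)) (sum≤product {size s} (s≤s (s≤s z≤n)) (2≤weight t σ)))

  2*vertices≤weight+4 : ∀ s t σ → 2 * length (allVertices (s ∷ t ∷ σ)) ≤ weight (s ∷ t ∷ σ) + 4
  2*vertices≤weight+4 s t σ = ℕ.≤-trans
    (ℕ.*-monoʳ-≤ 2 (ℕ.≤-trans (ℕ.≤-reflexive (length-++ (vertices s))) (ℕ.+-monoʳ-≤ (size s) (vertices≤weight t σ))))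
    (2*sum≤product+4 {size s} (s≤s (s≤s z≤n)) (2≤weight t σ))

  -- A leaf u of a star with other leaves is split off to form a new star with v;
  -- if u is the only leaf, it becomes the centre instead.
  attachToStar : ∀ s {u v} → u ∈ vertices s → Adjacent P u v →
    ∃ λ τ → allVertices τ ↭ v ∷ vertices s × 1 ≤ length τ
  attachToStar (star c x xs adj) {u} {v} (here refl) u~v =
    star c v (x ∷ xs) (u~v ∷ adj) ∷ [] ,
    ↭-trans (↭-reflexive (++-identityʳ _)) (swap c v ↭-refl) , s≤s z≤n
  attachToStar (star c x xs adj) {u} {v} (there u∈) u~v with ∈-∃++ u∈
  ... | as , bs , eq = split (as ++ bs) (↭-trans (↭-reflexive eq) (shift u as bs))
    where
    split : ∀ ys → x ∷ xs ↭ u ∷ ys → ∃ λ τ → allVertices τ ↭ v ∷ c ∷ x ∷ xs × 1 ≤ length τ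
    split [] p =
      star u c (v ∷ []) (adjacent-sym P (All.lookup adj u∈) ∷ u~v ∷ []) ∷ [] ,
      ↭-trans (swap u c ↭-refl) (↭-trans (prep c (swap u v ↭-refl))
        (↭-trans (swap c v ↭-refl) (prep v (prep c (↭-sym p))))) , s≤s z≤n
    split (y ∷ ys) p =
      star u v [] (u~v ∷ []) ∷ star c y ys (All.tail (All-resp-↭ p adj)) ∷ [] ,
      ↭-trans (↭-reflexive (cong (λ zs → u ∷ v ∷ c ∷ y ∷ zs) (++-identityʳ ys)))
        (↭-trans (swap u v ↭-refl) (prep v (↭-trans (swap u c ↭-refl) (prep c (↭-sym p))))) , s≤s z≤n

  -- The number of stars is tracked so that a cover grown from two disjoint edges still has at least
  -- two stars.
  attach : ∀ σ {u v} → u ∈ allVertices σ → Adjacent P u v →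
    ∃ λ τ → allVertices τ ↭ v ∷ allVertices σ × length σ ≤ length τ
  attach (s ∷ σ) {u} {v} u∈ u~v with ∈-++⁻ (vertices s) u∈
  ... | inj₁ u∈s with attachToStar s u∈s u~v
  ...   | τ , p , 1≤τ = τ ++ σ ,
    ↭-trans (↭-reflexive (concatMap-++ vertices τ σ)) (++⁺ʳ (allVertices σ) p) ,
    subst (suc (length σ) ≤_) (sym (length-++ τ)) (ℕ.+-monoˡ-≤ (length σ) 1≤τ)
  attach (s ∷ σ) {u} {v} u∈ u~v | inj₂ u∈σ with attach σ u∈σ u~v
  ...   | τ , p , σ≤τ = s ∷ τ ,
    ↭-trans (++⁺ˡ (vertices s) p) (shift v (vertices s) (allVertices σ)) , s≤s σ≤τ

  open import Data.List.Membership.DecPropositional (Fin._≟_ {n}) using (_∈?_)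

  module _ (neighbour : NoIsolated P) where

    -- Greedy extension of `σ`. An uncovered `v` has a neighbour `w`: if `w` is covered, `v` is
    -- attached there; otherwise `v` and `w` form a new star.
    cover : ∀ vs σ → Unique (allVertices σ) →
      ∃ λ τ → Unique (allVertices τ) × vs ⊆ allVertices τ × allVertices σ ⊆ allVertices τ × length σ ≤ length τ
    cover [] σ u = σ , u , (λ ()) , id , ℕ.≤-refl
    cover (v ∷ vs) σ u = combine extended
      where
      Extension = ∃ λ ρ → Unique (allVertices ρ) × v ∷ allVertices σ ⊆ allVertices ρ × length σ ≤ length ρ

      extended : Extension
      extended with v ∈? allVertices σ | neighbour v
      ... | yes v∈ | _ = σ , u , (λ { (here refl) → v∈ ; (there x∈) → x∈ }) , ℕ.≤-refl
      ... | no v∉ | w , v~w with w ∈? allVertices σ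
      ...   | yes w∈ = let ρ , p , σ≤ρ = attach σ w∈ (adjacent-sym P v~w) in
        ρ , Unique-resp-↭ (↭-sym p) (All.¬Any⇒All¬ _ v∉ ∷ u) , ∈-resp-↭ (↭-sym p) , σ≤ρ
      ...   | no w∉ = star v w [] (v~w ∷ []) ∷ σ ,
        (proj₁ v~w ∷ All.¬Any⇒All¬ _ v∉) ∷ All.¬Any⇒All¬ _ w∉ ∷ u ,
        (λ { (here refl) → here refl ; (there x∈) → there (there x∈) }) , ℕ.n≤1+n _

      combine : Extension → ∃ λ τ → Unique (allVertices τ) × v ∷ vs ⊆ allVertices τ × allVertices σ ⊆ allVertices τ × length σ ≤ length τ
      combine (ρ , uρ , ⊆ρ , σ≤ρ) with cover vs ρ uρ
      ... | τ , uτ , vs⊆ , ρ⊆ , ρ≤τ = τ , uτ ,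
        (λ { (here refl) → ρ⊆ (⊆ρ (here refl)) ; (there x∈) → vs⊆ x∈ }) ,
        ρ⊆ ∘ ⊆ρ ∘ there , ℕ.≤-trans σ≤ρ ρ≤τ

  two-stars-bound : 6 ≤ n → ∀ σ → Unique (allVertices σ) → allFin n ⊆ allVertices σ → 2 ≤ length σ → (n + 2) * ext P ≤ n !
  two-stars-bound 6≤n [] _ _ ()
  two-stars-bound 6≤n (_ ∷ []) _ _ (s≤s ())
  two-stars-bound 6≤n σ@(s ∷ t ∷ ρ) u covers _ = ℕ.≤-trans (ℕ.*-monoˡ-≤ (ext P) n+2≤weight) (ext-bound σ u)
    where
    open ℕ.≤-Reasoning
    n≤vertices : n ≤ length (allVertices σ)
    n≤vertices = subst (_≤ length (allVertices σ)) (length-tabulate {n = n} id) (unique-⊆⇒length≤ (Unique.allFin⁺ n) covers)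
    n+2≤weight : n + 2 ≤ weight σ
    -- Adding 4 to both sides avoids subtraction in the bound `2 n - 4`; `6 ≤ n` enters as
    -- `n + 6 ≤ n + n`.
    n+2≤weight = ℕ.+-cancelʳ-≤ 4 _ _ (begin
      n + 2 + 4                      ≡⟨ ℕ.+-assoc n 2 4 ⟩
      n + 6                          ≤⟨ ℕ.+-monoʳ-≤ n 6≤n ⟩
      n + n                          ≡⟨ cong (n +_) (sym (ℕ.+-identityʳ n)) ⟩
      2 * n                          ≤⟨ ℕ.*-monoʳ-≤ 2 n≤vertices ⟩
      2 * length (allVertices σ)     ≤⟨ 2*vertices≤weight+4 s t ρ ⟩
      weight σ + 4                   ∎)

  -- Posets whose comparabilities all pass through one point

  open IsDecPartialOrder isDecPartialOrder using (antisym) renaming (trans to ≤ₚ-trans)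

  -- Let `x` be the point that a bijection `g` sends to `e`. Exchanging `c` and `x` in `g` puts `c`
  -- at `e`, which gives a linear extension, and the same exchange recovers `g`. So `n` exchanges of
  -- linear extensions reach all bijections.
  n!≤n*ext : ∀ c (e : Fin n) → (∀ f → InjectiveVec f → lookup f c ≡ e → Monotone P f) → n ! ≤ n * ext P
  n!≤n*ext c e mono = subst₂ _≤_ (ext-antichain≡n! n)
    (trans (length-cartesianProductWith (exchange c) (allFin n) (linearExtensions P)) (cong (_* ext P) (length-tabulate {n = n} id)))
    (unique-⊆⇒length≤ (linearExtensions-unique (antichain n)) (λ {g} g∈ → reach g (∈-linearExtensions⇒injective (antichain n) g∈)))
    where
    gs = cartesianProductWith (exchange c) (allFin n) (linearExtensions P)
    reach : ∀ g → InjectiveVec g → g ∈ gs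
    reach g inj with injective⇒surjective (lookup g) inj e
    ... | x , gx≡e = subst (_∈ gs) exchanged-back (∈-cartesianProductWith⁺ (exchange c) (∈-allFin x) f∈)
      where
      f = exchange c x g
      f-inj : InjectiveVec f
      f-inj = exchange-injectiveVec c x g inj
      exchanged-back : exchange c x f ≡ g
      exchanged-back = lookup-ext λ i → trans (lookup-exchange c x f i)
        (trans (lookup-exchange c x g _) (cong (lookup g) (transpose-involutive c x i)))
      fc≡e : lookup f c ≡ e
      fc≡e = trans (lookup-exchange c x g c) (gx≡e (transpose-left c x))
      f∈ : f ∈ linearExtensions P
      f∈ = ∈-linearExtensions⁺ P (mkLinearExtension P f f-inj (mono f f-inj fc≡e))

  module _ (c : Fin n) (through-c : ∀ a b → a ≢ c → b ≢ c → ¬ Adjacent P a b) where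

    monotone-if-extremal : ∀ f → (∀ {y} → c ≤ₚ y → lookup f c Fin.≤ lookup f y) →
      (∀ {y} → y ≤ₚ c → lookup f y Fin.≤ lookup f c) → Monotone P f
    monotone-if-extremal f up down {i} {j} i≤j with i Fin.≟ c | j Fin.≟ c | i Fin.≟ j
    ... | yes refl | _        | _        = up i≤j
    ... | no _     | yes refl | _        = down i≤j
    ... | no _     | no _     | yes refl = ℕ.≤-refl
    ... | no i≢c   | no j≢c   | no i≢j   = contradiction (i≢j , inj₁ i≤j) (through-c i j i≢c j≢c)

    -- Elements on both sides of c would be comparable to each other.
    extremal : ∀ {x} → Adjacent P c x → (∀ {y} → y ≤ₚ c → y ≡ c) ⊎ (∀ {y} → c ≤ₚ y → y ≡ c)
    extremal {x} (c≢x , inj₁ c≤x) = inj₁ λ {y} y≤c → by-cases y y≤c (y Fin.≟ c)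
      where
      by-cases : ∀ y → y ≤ₚ c → Dec (y ≡ c) → y ≡ c
      by-cases y y≤c (yes y≡c) = y≡c
      by-cases y y≤c (no y≢c) = contradiction
        ((λ { refl → c≢x (antisym c≤x y≤c) }) , inj₁ (≤ₚ-trans y≤c c≤x)) (through-c y x y≢c (c≢x ∘ sym))
    extremal {x} (c≢x , inj₂ x≤c) = inj₂ λ {y} c≤y → by-cases y c≤y (y Fin.≟ c)
      where
      by-cases : ∀ y → c ≤ₚ y → Dec (y ≡ c) → y ≡ c
      by-cases y c≤y (yes y≡c) = y≡c
      by-cases y c≤y (no y≢c) = contradiction
        ((λ { refl → c≢x (antisym c≤y x≤c) }) , inj₂ (≤ₚ-trans x≤c c≤y)) (through-c y x y≢c (c≢x ∘ sym))

    -- A minimal `c` goes to the first position, a maximal one to the last; every bijection doing so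
    -- is monotone, as no other comparabilities exist.
    star-n!≤n*ext : ∀ {x} → Adjacent P c x → n ! ≤ n * ext P
    star-n!≤n*ext c~x with extremal c~x | least c | greatest c
    ... | inj₁ minimal | e , e≤ | _ =
      n!≤n*ext c e λ { f _ refl → monotone-if-extremal f (λ _ → e≤ _) (λ y≤c → ℕ.≤-reflexive (cong (Fin.toℕ ∘ lookup f) (minimal y≤c))) }
    ... | inj₂ maximal | _ | e , ≤e =
      n!≤n*ext c e λ { f _ refl → monotone-if-extremal f (λ c≤y → ℕ.≤-reflexive (cong (Fin.toℕ ∘ lookup f) (sym (maximal c≤y)))) (λ _ → ≤e _) }

  dichotomy : 6 ≤ n → NoIsolated P → (n + 2) * ext P ≤ n ! ⊎ n * ext P ≡ n !
  dichotomy 6≤n neighbour with cover neighbour (allFin n) [] []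
  ... | [] , _ , covers , _ = contradiction (covers (∈-allFin (Fin.fromℕ< (ℕ.≤-trans (s≤s z≤n) 6≤n)))) λ ()
  ... | σ@(_ ∷ _ ∷ _) , u , covers , _ = inj₁ (two-stars-bound 6≤n σ u covers (s≤s (s≤s z≤n)))
  ... | s ∷ [] , u , covers , _
    with Fin.any? (λ a → Fin.any? λ b → ¬? (a Fin.≟ centre s) ×-dec ¬? (b Fin.≟ centre s) ×-dec adjacent? P a b)
  -- Every edge meets the centre, so the upper bound from the single star and the lower bound
  -- `star-n!≤n*ext` coincide.
  ...   | no ¬edge = inj₂ (ℕ.≤-antisym
    (ℕ.≤-trans (ℕ.*-monoˡ-≤ (ext P) n≤weight) (ext-bound (s ∷ []) u))
    (star-n!≤n*ext (centre s) (λ a b a≢c b≢c a~b → ¬edge (a , b , a≢c , b≢c , a~b)) (All.head (adjacent s))))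
    where
    n≤weight : n ≤ weight (s ∷ [])
    n≤weight = ℕ.≤-trans
      (subst (_≤ length (allVertices (s ∷ []))) (length-tabulate {n = n} id) (unique-⊆⇒length≤ (Unique.allFin⁺ n) covers))
      (vertices≤weight s [])
  -- The covering star contains every point, so any `z` other than `a`, `b` and the centre is a
  -- leaf. Then `a b` and `c z` are disjoint edges, and a cover grown from them has at least two
  -- stars.
  ...   | yes (a , b , a≢c , b≢c , a~b) with Fin.any? (λ z → ¬? (z ∈? (a ∷ b ∷ centre s ∷ [])))
  ...     | no ¬z = contradiction (ℕ.≤-trans 6≤n n≤3) λ { (s≤s (s≤s (s≤s ()))) }
    where
    n≤3 : n ≤ 3
    n≤3 = subst (_≤ 3) (length-tabulate {n = n} id) (unique-⊆⇒length≤ (Unique.allFin⁺ n)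
      λ {z} _ → decidable-stable (z ∈? (a ∷ b ∷ centre s ∷ [])) λ z∉ → ¬z (z , z∉))
  ...     | yes (z , z∉) =
    let τ , uτ , covers′ , _ , 2≤τ = cover neighbour (allFin n)
          (star a b [] (a~b ∷ []) ∷ star c z [] (c~z ∷ []) ∷ [])
          ((proj₁ a~b ∷ a≢c ∷ a≢z ∷ []) ∷ (b≢c ∷ b≢z ∷ []) ∷ (proj₁ c~z ∷ []) ∷ [] ∷ [])
    in inj₁ (two-stars-bound 6≤n τ uτ covers′ 2≤τ)
    where
    c = centre s
    a≢z : a ≢ z
    a≢z refl = z∉ (here refl)
    b≢z : b ≢ z
    b≢z refl = z∉ (there (here refl))
    c~z : Adjacent P c z
    c~z with ∈-++⁻ (vertices s) (covers (∈-allFin z))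
    ... | inj₁ (here refl) = contradiction (there (there (here refl))) z∉
    ... | inj₁ (there z∈) = All.lookup (adjacent s) z∈

-- Finiteness of LE n

module _ (n : ℕ) (M : Vec (Fin 2) (n * n)) where

  -- A `FinPoset` holds a relation valued in types, so its 0-1 matrix is listed instead: `allVecs`
  -- enumerates all matrices, and `ext` depends on the relation only up to equivalence.
  matrixRel : Fin n → Fin n → Set
  matrixRel i j = lookup M (Fin.combine i j) ≡ Fin.suc Fin.zero

  matrixRel? : ∀ i j → Dec (matrixRel i j)
  matrixRel? i j = lookup M (Fin.combine i j) Fin.≟ Fin.suc Fin.zero

  IsOrderMatrix : Set
  IsOrderMatrix = (∀ i → matrixRel i i) × (∀ i j → matrixRel i j → matrixRel j i → i ≡ j) ×
    (∀ i j k → matrixRel i j → matrixRel j k → matrixRel i k)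

  isOrderMatrix? : Dec IsOrderMatrix
  isOrderMatrix? = Fin.all? (λ i → matrixRel? i i)
    ×-dec Fin.all? (λ i → Fin.all? λ j → matrixRel? i j →-dec (matrixRel? j i →-dec (i Fin.≟ j)))
    ×-dec Fin.all? (λ i → Fin.all? λ j → Fin.all? λ k → matrixRel? i j →-dec (matrixRel? j k →-dec matrixRel? i k))

  fromOrderMatrix : IsOrderMatrix → FinPoset n
  fromOrderMatrix (rfl , asym , trns) = record
    { _≤ₚ_ = matrixRel
    ; isDecPartialOrder = record
      { isPartialOrder = record
        { isPreorder = record { isEquivalence = isEquivalence ; reflexive = λ { refl → rfl _ } ; trans = trns _ _ _ }
        ; antisym = asym _ _ }
      ; _≟_ = Fin._≟_
      ; _≤?_ = matrixRel? } }

  -- Matrices that do not represent an order are sent to the antichain.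
  fromMatrix : FinPoset n
  fromMatrix with isOrderMatrix?
  ... | no _   = antichain n
  ... | yes po = fromOrderMatrix po

  ext-fromMatrix : (P : FinPoset n) → let open FinPoset P in
    (∀ {i j} → matrixRel i j → i ≤ₚ j) → (∀ {i j} → i ≤ₚ j → matrixRel i j) → ext fromMatrix ≡ ext P
  ext-fromMatrix P sound complete with isOrderMatrix?
  ... | yes po = ext-cong (fromOrderMatrix po) P sound complete
  ... | no ¬po = contradiction
    ((λ i → complete PO.refl) , (λ i j p q → PO.antisym (sound p) (sound q)) , λ i j k p q → complete (PO.trans (sound p) (sound q))) ¬po
    where module PO = IsDecPartialOrder (FinPoset.isDecPartialOrder P)

module _ (P : FinPoset n) where
  open FinPoset P

  private
    entry : Fin n → Fin n → Fin 2
    entry i j with i ≤ₚ? j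
    ... | yes _ = Fin.suc Fin.zero
    ... | no  _ = Fin.zero

    entry⁺ : ∀ {i j} → i ≤ₚ j → entry i j ≡ Fin.suc Fin.zero
    entry⁺ {i} {j} i≤j with i ≤ₚ? j
    ... | yes _   = refl
    ... | no  i≰j = contradiction i≤j i≰j

    entry⁻ : ∀ {i j} → entry i j ≡ Fin.suc Fin.zero → i ≤ₚ j
    entry⁻ {i} {j} eq with i ≤ₚ? j
    ... | yes i≤j = i≤j

  toMatrix : Vec (Fin 2) (n * n)
  toMatrix = tabulate λ k → let i , j = Fin.remQuot {n} n k in entry i j

  lookup-toMatrix : ∀ i j → lookup toMatrix (Fin.combine i j) ≡ entry i j
  lookup-toMatrix i j = trans (lookup∘tabulate _ (Fin.combine i j))
    (cong (λ p → entry (proj₁ p) (proj₂ p)) (Fin.remQuot-combine i j))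

  ext-toMatrix : ext (fromMatrix n toMatrix) ≡ ext P
  ext-toMatrix = ext-fromMatrix n toMatrix P
    (λ {i} {j} eq → entry⁻ (trans (sym (lookup-toMatrix i j)) eq)) (λ {i} {j} i≤j → trans (lookup-toMatrix i j) (entry⁺ i≤j))

extValues : ∀ n → List ℕ
extValues n = List.map (ext ∘ fromMatrix n) (allVecs 2 (n * n))

∈-extValues⁺ : ∀ {k} → LE n k → k ∈ extValues n
∈-extValues⁺ {n} (P , refl) = subst (_∈ _) (ext-toMatrix P) (∈-map⁺ (ext ∘ fromMatrix n) (∈-allVecs (toMatrix P)))

∈-extValues⁻ : ∀ {k} → k ∈ extValues n → LE n k
∈-extValues⁻ {n} k∈ = let M , _ , k≡ = ∈-map⁻ (ext ∘ fromMatrix n) k∈ in fromMatrix n M , sym k≡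

-- The exact set is listed by filtering and deduplicating `extValues`. The list `ks` only bounds its
-- length and may contain repetitions or values that are not attained.
LE-interval-cardinality : ∀ n a b (ks : List ℕ) → (∀ {k} → LE n k → ⦅ a , b ⟧ k → k ∈ ks) →
  ∃ λ m → HasCardinality (LE n ∩ ⦅ a , b ⟧) m × m ≤ length ks
LE-interval-cardinality n a b ks bound =
  length values , (values , unique , (λ k → mk⇔ (sound k) (complete k)) , refl) ,
  unique-⊆⇒length≤ unique λ {k} k∈ → let le , int = sound k k∈ in bound le int
  where
  int? : ∀ k → Dec (⦅ a , b ⟧ k)
  int? k = (a ℕ.<? k) ×-dec (k ℕ.≤? b)
  values = deduplicate ℕ._≟_ (filter int? (extValues n))
  unique : Unique values
  unique = deduplicate-! ℕ._≟_ (filter int? (extValues n))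
  sound : ∀ k → k ∈ values → (LE n ∩ ⦅ a , b ⟧) k
  sound k k∈ =
    let k∈′ , int = ∈-filter⁻ int? {xs = extValues n} (∈-deduplicate⁻ ℕ._≟_ (filter int? (extValues n)) k∈)
    in ∈-extValues⁻ k∈′ , int
  complete : ∀ k → (LE n ∩ ⦅ a , b ⟧) k → k ∈ values
  complete k (le , int) = ∈-deduplicate⁺ ℕ._≟_ (∈-filter⁺ int? (∈-extValues⁺ le) int)

-- The possible values above (n ∸ 1) !

noIsolated⇒ext≡ : (P : FinPoset (suc n)) → 6 ≤ suc n → NoIsolated P → suc n ! < (suc n + 2) * ext P → ext P ≡ n !
noIsolated⇒ext≡ {n} P 6≤ neighbour large with dichotomy P 6≤ neighbour
... | inj₁ small = contradiction small (ℕ.<⇒≱ large)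
... | inj₂ exact = ℕ.*-cancelˡ-≡ _ _ (suc n) exact

-- Here `n = 3 + k`, and the constructors count the isolated points deleted. In the last one, `j`
-- stands for `ext` of the remaining `k`-point poset.
data LargeValue (k : ℕ) : ℕ → Set where
  one-isolated   : LargeValue k ((3 + k) * (1 + k) !)
  two-isolated   : LargeValue k ((3 + k) * ((2 + k) * k !))
  three-isolated : ∀ j → LargeValue k ((3 + k) * ((2 + k) * ((1 + k) * j)))

module _ {k : ℕ} (5≤k : 5 ≤ k) where

  -- The hypothesis is `(n-1)! < ext P` divided by `n - 1`. For `m = n - 2` points the factor left
  -- is `n = m + 2`, exactly the one excluded by `dichotomy`.
  twoIsolated-largeValue : (R : FinPoset (1 + k)) → (1 + k) ! < (1 + k + 2) * ext R →
    LargeValue k ((3 + k) * ((2 + k) * ext R))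
  twoIsolated-largeValue R large = by-cases (isolated? R)
    where
    by-cases : ∃ (Isolated R) ⊎ NoIsolated R → LargeValue k ((3 + k) * ((2 + k) * ext R))
    by-cases (inj₁ (z , z-iso)) = subst (λ e → LargeValue k ((3 + k) * ((2 + k) * e)))
      (sym (ext-remove R z z-iso)) (three-isolated (ext (remove R z)))
    by-cases (inj₂ neighbour) = subst (λ e → LargeValue k ((3 + k) * ((2 + k) * e)))
      (sym (noIsolated⇒ext≡ R (s≤s 5≤k) neighbour large)) two-isolated

  oneIsolated-largeValue : (Q : FinPoset (2 + k)) → (2 + k) ! < (3 + k) * ext Q → LargeValue k ((3 + k) * ext Q)
  oneIsolated-largeValue Q large = by-cases (isolated? Q)
    where
    identity : ∀ k e → (3 + k) * ((2 + k) * e) ≡ (2 + k) * ((1 + k + 2) * e)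
    identity = solve-∀
    by-cases : ∃ (Isolated Q) ⊎ NoIsolated Q → LargeValue k ((3 + k) * ext Q)
    by-cases (inj₁ (y , y-iso)) = subst (λ e → LargeValue k ((3 + k) * e)) (sym eq)
      (twoIsolated-largeValue (remove Q y) (ℕ.*-cancelˡ-< (2 + k) _ _
        (subst ((2 + k) ! <_) (trans (cong ((3 + k) *_) eq) (identity k (ext (remove Q y)))) large)))
      where
      eq : ext Q ≡ (2 + k) * ext (remove Q y)
      eq = ext-remove Q y y-iso
    -- With `m = 2 + k` points the hypothesis has the factor `m + 1`, so it also holds with the
    -- factor `m + 2` of `dichotomy`.
    by-cases (inj₂ neighbour) = subst (λ e → LargeValue k ((3 + k) * e))
      (sym (noIsolated⇒ext≡ Q (s≤s (ℕ.m≤n⇒m≤1+n 5≤k)) neighbour (ℕ.<-≤-trans large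
        (ℕ.*-monoˡ-≤ (ext Q) (ℕ.≤-trans (ℕ.n≤1+n (3 + k)) (ℕ.≤-reflexive (ℕ.+-comm 2 (2 + k)))))))) one-isolated

  largeValue : (P : FinPoset (3 + k)) → (2 + k) ! < ext P → LargeValue k (ext P)
  largeValue P large = by-cases (isolated? P)
    where
    by-cases : ∃ (Isolated P) ⊎ NoIsolated P → LargeValue k (ext P)
    by-cases (inj₁ (x , x-iso)) = subst (LargeValue k) (sym eq)
      (oneIsolated-largeValue (remove P x) (subst ((2 + k) ! <_) eq large))
      where
      eq : ext P ≡ (3 + k) * ext (remove P x)
      eq = ext-remove P x x-iso
    -- Without isolated points `ext P` would be exactly `(2 + k) !`, which the strict bound
    -- excludes.
    by-cases (inj₂ neighbour) = contradiction
      (noIsolated⇒ext≡ P (s≤s (ℕ.m≤n⇒m≤o+n 2 5≤k)) neighbour (ℕ.<-≤-trans (ℕ.*-monoʳ-< (3 + k) large)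
        (ℕ.*-monoˡ-≤ (ext P) (ℕ.m≤m+n (3 + k) 2))))
      (ℕ.<⇒≢ large ∘ sym)

-- Rules out `j ≤ 3` among the values with three isolated points. The base case is 24 ≤ 120; then
-- the left side grows by 3 and the right by `(5 + i) * (5 + i) !`.
3*[3+k]≤k! : ∀ {k} → 5 ≤ k → 3 * (3 + k) ≤ k !
3*[3+k]≤k! {k} 5≤k = subst (λ k → 3 * (3 + k) ≤ k !) (ℕ.m+[n∸m]≡n 5≤k) (go (k ∸ 5))
  where
  open ℕ.≤-Reasoning
  go : ∀ i → 3 * (8 + i) ≤ (5 + i) !
  go zero    = ℕ.m≤m+n 24 96
  go (suc i) = begin
    3 * (8 + suc i)                     ≡⟨ identity i ⟩
    3 * (8 + i) + 3                     ≤⟨ ℕ.+-mono-≤ (go i) (ℕ.≤-trans (ℕ.m≤m*n 3 (8 + i)) (ℕ.≤-trans (go i) (ℕ.m≤n*m ((5 + i) !) (5 + i)))) ⟩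
    (5 + i) ! + (5 + i) * (5 + i) !     ∎
    where
    identity : ∀ i → 3 * (8 + suc i) ≡ 3 * (8 + i) + 3
    identity = solve-∀

-- The factor `4 + i` runs from 4 to `k !`, which is `k ! - 3` values; the two others bring the
-- length to `k ! - 1`.
candidates : ℕ → List ℕ
candidates k = (3 + k) * (1 + k) ! ∷ (3 + k) * ((2 + k) * k !) ∷
  List.map (λ i → (3 + k) * ((2 + k) * ((1 + k) * (4 + i)))) (upTo (k ! ∸ 3))

largeValue⇒∈candidates : ∀ {k e} → 5 ≤ k → LargeValue k e → ⦅ (2 + k) ! , (3 + k) ! ⟧ e → e ∈ candidates k
largeValue⇒∈candidates _ one-isolated _ = here refl
largeValue⇒∈candidates _ two-isolated _ = there (here refl)
largeValue⇒∈candidates {k} 5≤k (three-isolated j) (lower , upper) with 4 ℕ.≤? j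
... | no j≱4 = contradiction lower (ℕ.≤⇒≯ (begin
  (3 + k) * ((2 + k) * ((1 + k) * j))   ≤⟨ ℕ.*-monoʳ-≤ (3 + k) (ℕ.*-monoʳ-≤ (2 + k) (ℕ.*-monoʳ-≤ (1 + k) (ℕ.≤-pred (ℕ.≰⇒> j≱4)))) ⟩
  (3 + k) * ((2 + k) * ((1 + k) * 3))   ≡⟨ identity k ⟩
  (2 + k) * ((1 + k) * (3 * (3 + k)))   ≤⟨ ℕ.*-monoʳ-≤ (2 + k) (ℕ.*-monoʳ-≤ (1 + k) (3*[3+k]≤k! 5≤k)) ⟩
  (2 + k) * ((1 + k) * k !)             ∎))
  where
  open ℕ.≤-Reasoning
  identity : ∀ k → (3 + k) * ((2 + k) * ((1 + k) * 3)) ≡ (2 + k) * ((1 + k) * (3 * (3 + k)))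
  identity = solve-∀
... | yes 4≤j = there (there (subst (_∈ List.map (f ∘ (4 +_)) (upTo (k ! ∸ 3))) (cong f (ℕ.m+[n∸m]≡n 4≤j))
  (∈-map⁺ (f ∘ (4 +_)) (∈-upTo⁺ j∸4<))))
  where
  f : ℕ → ℕ
  f j = (3 + k) * ((2 + k) * ((1 + k) * j))
  j≤k! : j ≤ k !
  j≤k! = ℕ.*-cancelˡ-≤ (1 + k) (ℕ.*-cancelˡ-≤ (2 + k) (ℕ.*-cancelˡ-≤ (3 + k) upper))
  j∸4< : j ∸ 4 < k ! ∸ 3
  -- `suc (j ∸ 4)` equals `suc j ∸ 4`, which computes to `j ∸ 3`.
  j∸4< = ℕ.≤-trans (ℕ.≤-reflexive (sym (ℕ.+-∸-assoc 1 4≤j))) (ℕ.∸-monoˡ-≤ 3 j≤k!)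

length-candidates : ∀ {k} → 5 ≤ k → length (candidates k) < k !
length-candidates {k} 5≤k = ℕ.≤-reflexive (trans
  -- The 3 consists of the first two candidates and the successor inside `_<_`.
  (cong (3 +_) (trans (length-map _ (upTo (k ! ∸ 3))) (length-upTo (k ! ∸ 3))))
  (ℕ.m+[n∸m]≡n (ℕ.≤-trans (ℕ.m≤m*n 3 (3 + k)) (3*[3+k]≤k! 5≤k))))

theorem1p3 : (n : ℕ) → 8 ≤ n → ∃ λ (m : ℕ) → HasCardinality (LE n ∩ ⦅ (n ∸ 1) ! , n ! ⟧) m × m < (n ∸ 3) !
theorem1p3 (suc (suc (suc k))) (s≤s (s≤s (s≤s 5≤k))) =
  let m , card , m≤ = LE-interval-cardinality (3 + k) ((2 + k) !) ((3 + k) !) (candidates k)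
        (λ { (P , refl) int → largeValue⇒∈candidates 5≤k (largeValue 5≤k P (proj₁ int)) int })
  in m , card , ℕ.≤-<-trans m≤ (length-candidates 5≤k)
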